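{- Let $f\in F(n)$ be a derangement (a permutation of $\{0,1\}^n$ with no fixed point). Then there exists $h\in F(n)$ with $h\sim f$ such that, for all $x,y\in\{0,1\}^n$, $\mathcal{A}(h)$ has a path from $x$ to $y$ of length at most $d(x,y)+4$.
   Context: $F(n)$ is the set of all functions $f:\{0,1\}^n\to\{0,1\}^n$, written $f=(f_1,\dots,f_n)$. $e_i$ is the configuration with a $1$ exactly in component $i$; addition is componentwise modulo $2$. The asynchronous graph $\mathcal{A}(f)$ is the digraph on $\{0,1\}^n$ with an arc from $x$ to $x+e_i$ whenever $f_i(x)\neq x_i$. $d(x,y)$ is the Hamming distance (number of components where $x$ and $y$ differ). $\mathcal{S}(f)$ has an arc $x\to f(x)$; $f\sim h$ means $\mathcal{S}(f)$ and $\mathcal{S}(h)$ are isomorphic. -}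

module Defs where

open import Data.Bool using (Bool; true; false; not; _xor_)
open import Data.Nat using (ℕ; zero; suc; _+_; _≤_)
open import Data.Fin using (Fin)
open import Data.Vec using (Vec; lookup; updateAt; []; _∷_)
open import Data.Product using (Σ; ∃; ∃-syntax; _×_; _,_)
open import Relation.Binary.PropositionalEquality using (_≡_; _≢_)
open import Relation.Nullary using (¬_)
open import Function.Bundles using (Bijection; _⤖_; _⇔_)

Config : ℕ → Set
Config n = Vec Bool n

F : ℕ → Set
F n = Config n → Config n

comp : ∀ {n} → F n → Fin n → Config n → Bool
comp f i x = lookup (f x) i

flip : ∀ {n} → Config n → Fin n → Config n
flip x i = updateAt x i not

hamming : ∀ {n} → Config n → Config n → ℕ
hamming [] [] = 0
hamming (a ∷ x) (b ∷ y) with a xor b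
... | true  = suc (hamming x y)
... | false = hamming x y

IsPermutation : ∀ {n} → F n → Set
IsPermutation {n} f = Σ (Config n → Config n) λ g →
  (∀ x → g (f x) ≡ x) × (∀ x → f (g x) ≡ x)

IsDerangement : ∀ {n} → F n → Set
IsDerangement f = IsPermutation f × (∀ x → f x ≢ x)

AsyncArc : ∀ {n} → F n → Config n → Config n → Set
AsyncArc f x y = ∃[ i ] (comp f i x ≢ lookup x i × y ≡ flip x i)

data Path {n} (f : F n) : Config n → Config n → ℕ → Set where
  [] : ∀ {x} → Path f x x 0
  _∷_ : ∀ {x y z k} → AsyncArc f x y → Path f y z k → Path f x z (suc k)

SyncArc : ∀ {n} → F n → Config n → Config n → Set
SyncArc f x y = y ≡ f x

Similar : ∀ {n} → F n → F n → Set
Similar {n} f h = Σ (Config n ⤖ Config n) λ φ →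
  ∀ x y → SyncArc f x y ⇔ SyncArc h (Bijection.to φ x) (Bijection.to φ y)

{-# OPTIONS --safe #-}
module Submission where

-- Call the configurations with first two coordinates 00, 10, 11, 01 layers 0, 1, 2, 3.  It is enough that h moves every
-- layer l into layers l + 1 and l + 2 (mod 4) and complements the remaining coordinates on layer 0.  Then A(h) contains
-- the rotation 00 → 10 → 11 → 01 → 00 over each choice of the remaining coordinates, and on layer 0 any of these can be
-- flipped.  A path rotates to layer 0, flips there what is needed, and rotates to the target layer; if it starts in
-- layer i and ends in layer j it makes at most (-i mod 4) + j rotation steps, which exceeds the distance of the two
-- prefixes by at most 4.
--
-- To find h, label the vertices by ℤ/4 so that f increases labels by 1 or 2 and all four labels are equally frequent.
-- A cycle of any length ≥ 2 has such labellings, balanced up to a surplus that is empty, a label, a pair {a, a+2} or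
-- three labels, according to its length mod 4, and the rotation of the labels can be chosen cycle by cycle so that the
-- accumulated surplus always keeps one of these shapes; it ends up empty because 4 divides 2ⁿ.

open import Defs
open import Data.Nat using (ℕ; _+_; _≤_)
open import Data.Product using (Σ; ∃; _×_)

open import Data.Bool using (Bool; true; false; not)
open import Data.Bool.Properties using (not-¬; not-involutive) renaming (_≟_ to _≟ᵇ_)
open import Data.Fin using (Fin; zero; suc; toℕ; combine; remQuot)
open import Data.Fin.Patterns
open import Data.Fin.Properties using (all?; any?; pigeonhole; combine-remQuot; remQuot-combine) renaming (_≟_ to _≟ᶠ_)
open import Data.List using (List; []; _∷_; _++_; length; map; filter; allFin)
open import Data.List.Membership.Propositional using (_∈_)
open import Data.List.Membership.Propositional.Properties using (∈-∃++; ∈-++⁺ˡ; ∈-++⁺ʳ; ∈-++⁻; ∈-map⁺; ∈-map⁻; ∈-filter⁺; ∈-filter⁻; ∈-allFin)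
open import Data.List.Properties using (length-++; length-map; length-tabulate; map-++)
open import Data.List.Relation.Binary.Permutation.Propositional using (_↭_; prep; ↭-refl; ↭-sym; ↭-trans; ↭⇒↭ₛ)
open import Data.List.Relation.Binary.Permutation.Propositional.Properties using (↭-length; ∈-resp-↭; shift; ++-comm)
open import Data.List.Relation.Binary.Permutation.Setoid.Properties using (Unique-resp-↭)
open import Data.List.Relation.Unary.All as All using (All; []; _∷_)
open import Data.List.Relation.Unary.AllPairs using ([]; _∷_)
open import Data.List.Relation.Unary.Any using (here; there)
open import Data.List.Relation.Unary.Unique.Propositional using (Unique)
import Data.List.Relation.Unary.Unique.Propositional.Properties as Unique
open import Data.Nat using (zero; suc; _*_; _^_; _∸_; _<_; z≤n; s≤s)
open import Data.Nat.DivMod using (_%_; [m+kn]%n≡m%n; m*n%n≡0)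
open import Data.Nat.Properties
open import Data.Nat.Solver using (module +-*-Solver)
open import Data.Product using (_,_; proj₁; proj₂)
open import Data.Sum using (_⊎_; inj₁; inj₂)
open import Data.Vec as Vec using ([]; _∷_; lookup)
open import Data.Vec.Properties using (≡-dec; lookup-map; map-∘; map-cong; map-id)
open import Function using (_∘_; id; mk⤖; mk⇔)
open import Function.Definitions using (Injective)
open import Relation.Binary.PropositionalEquality
open import Relation.Nullary using (Dec; yes; no; ¬_; contradiction)
open import Relation.Nullary.Decidable using (from-yes; map′; _×-dec_; ¬?)

private variable
  A B : Set

-- Enumerations of the hypercube

fromBool : Bool → Fin 2
fromBool false = 0F
fromBool true  = 1F

toBool : Fin 2 → Bool
toBool 0F = false
toBool 1F = true

toBool-fromBool : ∀ b → toBool (fromBool b) ≡ b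
toBool-fromBool false = refl
toBool-fromBool true  = refl

fromBool-toBool : ∀ i → fromBool (toBool i) ≡ i
fromBool-toBool 0F = refl
fromBool-toBool 1F = refl

encode : ∀ {n} → Config n → Fin (2 ^ n)
encode []      = 0F
encode (b ∷ x) = combine (fromBool b) (encode x)

decode : ∀ {n} → Fin (2 ^ n) → Config n
decode {zero}  i = []
decode {suc n} i = let b , k = remQuot {2} (2 ^ n) i in toBool b ∷ decode k

decode-encode : ∀ {n} (x : Config n) → decode (encode x) ≡ x
decode-encode []              = refl
decode-encode {suc n} (b ∷ x) = trans
  (cong (λ p → toBool (proj₁ p) ∷ decode (proj₂ p)) (remQuot-combine {2} {2 ^ n} (fromBool b) (encode x)))
  (cong₂ _∷_ (toBool-fromBool b) (decode-encode x))

encode-decode : ∀ {n} (i : Fin (2 ^ n)) → encode (decode {n} i) ≡ i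
encode-decode {zero}  0F = refl
encode-decode {suc n} i  = let b , k = remQuot {2} (2 ^ n) i in trans
  (cong₂ combine (fromBool-toBool b) (encode-decode {n} k))
  (combine-remQuot {2} (2 ^ n) i)

decode-injective : ∀ {n} {i j : Fin (2 ^ n)} → decode {n} i ≡ decode j → i ≡ j
decode-injective {n} eq = trans (sym (encode-decode {n} _)) (trans (cong encode eq) (encode-decode {n} _))

_≟ᶜ_ : ∀ {n} (x y : Config n) → Dec (x ≡ y)
_≟ᶜ_ = ≡-dec _≟ᵇ_

configs : ∀ n → List (Config n)
configs n = map decode (allFin (2 ^ n))

∈-configs : ∀ {n} (x : Config n) → x ∈ configs n
∈-configs x = subst (_∈ configs _) (decode-encode x) (∈-map⁺ decode (∈-allFin (encode x)))

configs-unique : ∀ n → Unique (configs n)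
configs-unique n = Unique.map⁺ (decode-injective {n}) (Unique.allFin⁺ _)

length-configs : ∀ n → length (configs n) ≡ 2 ^ n
length-configs n = trans (length-map (decode {n}) (allFin (2 ^ n))) (length-tabulate id)

-- Duplicate-free lists

-- Each head is found in `ys` and moved to the front; the later elements differ from it, so they
-- stay in the remainder. It yields both length comparisons and the filling of partially prescribed
-- rows.
extract : {xs ys : List A} → Unique xs → (∀ {x} → x ∈ xs → x ∈ ys) → ∃ λ zs → ys ↭ xs ++ zs
extract {ys = ys} []          sub = ys , ↭-refl
extract           (x∉xs ∷ u) sub with ∈-∃++ (sub (here refl))
... | as , bs , refl =
  let zs , p = extract u λ y∈xs → remaining (All.lookup x∉xs y∈xs) (∈-resp-↭ (shift _ as bs) (sub (there y∈xs)))
  in  zs , ↭-trans (shift _ as bs) (prep _ p)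
  where
  remaining : ∀ {x y : A} {cs} → x ≢ y → y ∈ x ∷ cs → y ∈ cs
  remaining x≢y (here y≡x) = contradiction (sym y≡x) x≢y
  remaining x≢y (there y∈) = y∈

at : (xs : List A) → ∀ {k} → length xs ≡ k → Fin k → A
at (x ∷ xs) {suc _} eq zero    = x
at (x ∷ xs) {suc _} eq (suc i) = at xs (suc-injective eq) i

at-∈ : (xs : List A) → ∀ {k} (eq : length xs ≡ k) i → at xs eq i ∈ xs
at-∈ (x ∷ xs) {suc _} eq zero    = here refl
at-∈ (x ∷ xs) {suc _} eq (suc i) = there (at-∈ xs (suc-injective eq) i)

∈⇒at : {xs : List A} → ∀ {k} (eq : length xs ≡ k) {x} → x ∈ xs → ∃ λ i → at xs eq i ≡ x
∈⇒at {k = suc _} eq (here refl) = zero , refl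
∈⇒at {k = suc _} eq (there x∈)  = let i , p = ∈⇒at (suc-injective eq) x∈ in suc i , p

at-injective : {xs : List A} → Unique xs → ∀ {k} (eq : length xs ≡ k) {i j} → at xs eq i ≡ at xs eq j → i ≡ j
at-injective (x∉ ∷ u) {suc _} eq {zero}  {zero}  p = refl
at-injective (x∉ ∷ u) {suc _} eq {zero}  {suc j} p = contradiction p (All.lookup x∉ (at-∈ _ _ j))
at-injective (x∉ ∷ u) {suc _} eq {suc i} {zero}  p = contradiction (sym p) (All.lookup x∉ (at-∈ _ _ i))
at-injective (x∉ ∷ u) {suc _} eq {suc i} {suc j} p = cong suc (at-injective u (suc-injective eq) p)

at-map : (f : A → B) (xs : List A) → ∀ {k} (e : length xs ≡ k) (e′ : length (map f xs) ≡ k) i →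
  f (at xs e i) ≡ at (map f xs) e′ i
at-map f (x ∷ xs) {suc _} e e′ zero    = refl
at-map f (x ∷ xs) {suc _} e e′ (suc i) = at-map f xs (suc-injective e) (suc-injective e′) i

-- All three lists break after `length as` entries: before the break `f` is read off the second
-- list, after it off the third. `us` and `vs` are arbitrary filling.
at-aligned : (f : A → B) (as : List A) {bs : List A} {us : List B} (vs : List B) → ∀ {k}
  (e₀ : length (as ++ bs) ≡ k) (e₁ : length (map f as ++ us) ≡ k) (e₂ : length (vs ++ map f bs) ≡ k) →
  length vs ≡ length as → ∀ i →
  f (at (as ++ bs) e₀ i) ≡ at (map f as ++ us) e₁ i ⊎ f (at (as ++ bs) e₀ i) ≡ at (vs ++ map f bs) e₂ i
at-aligned f []       {bs} []       e₀ e₁ e₂ _ i = inj₂ (at-map f bs e₀ e₂ i)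
at-aligned f (a ∷ as) (v ∷ vs) {suc _} e₀ e₁ e₂ e zero    = inj₁ refl
at-aligned f (a ∷ as) (v ∷ vs) {suc _} e₀ e₁ e₂ e (suc i) =
  at-aligned f as vs (suc-injective e₀) (suc-injective e₁) (suc-injective e₂) (suc-injective e) i

filter-split : {P : A → Set} (P? : ∀ x → Dec (P x)) (xs : List A) → xs ↭ filter P? xs ++ filter (λ x → ¬? (P? x)) xs
filter-split P? []       = ↭-refl
filter-split P? (x ∷ xs) with P? x
... | yes _ = prep x (filter-split P? xs)
... | no  _ = ↭-trans (prep x (filter-split P? xs)) (↭-sym (shift x (filter P? xs) _))

-- Labels

next : Fin 4 → Fin 4
next 0F = 1F
next 1F = 2F
next 2F = 3F
next 3F = 0F

_+ˡ_ : Fin 4 → ℕ → Fin 4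
l +ˡ zero  = l
l +ˡ suc k = next l +ˡ k

Step : Fin 4 → Fin 4 → Set
Step l m = m ≡ l +ˡ 1 ⊎ m ≡ l +ˡ 2

δ : Fin 4 → Fin 4 → ℕ
δ i l with i ≟ᶠ l
... | yes _ = 1
... | no  _ = 0

count : Fin 4 → List (A × Fin 4) → ℕ
count i []             = 0
count i ((_ , l) ∷ xs) = δ i l + count i xs

count-++ : ∀ i (xs ys : List (A × Fin 4)) → count i (xs ++ ys) ≡ count i xs + count i ys
count-++ i []             ys = refl
count-++ i ((_ , l) ∷ xs) ys = trans (cong (δ i l +_) (count-++ i xs ys)) (sym (+-assoc (δ i l) _ _))

count-total : (xs : List (A × Fin 4)) → count 0F xs + count 1F xs + count 2F xs + count 3F xs ≡ length xs
count-total []             = refl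
count-total ((_ , l) ∷ xs) = trans
  (rearrange (δ 0F l) (δ 1F l) (δ 2F l) (δ 3F l) (count 0F xs) _ _ _)
  (cong₂ _+_ (δ-total l) (count-total xs))
  where
  δ-total : ∀ l → δ 0F l + δ 1F l + δ 2F l + δ 3F l ≡ 1
  δ-total = from-yes (all? λ l → δ 0F l + δ 1F l + δ 2F l + δ 3F l ≟ 1)
  rearrange : ∀ a b c d a′ b′ c′ d′ →
    (a + a′) + (b + b′) + (c + c′) + (d + d′) ≡ (a + b + c + d) + (a′ + b′ + c′ + d′)
  rearrange = solve 8 (λ a b c d a′ b′ c′ d′ →
    (a :+ a′) :+ (b :+ b′) :+ (c :+ c′) :+ (d :+ d′) := (a :+ b :+ c :+ d) :+ (a′ :+ b′ :+ c′ :+ d′)) refl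
    where open +-*-Solver

-- surplus c t i is the multiplicity of the label i in the surplus of shape c and position t.
surplus : Fin 4 → Fin 4 → Fin 4 → ℕ
surplus 0F t i = 0
surplus 1F t i = δ i (t +ˡ 3)
surplus 2F t i = δ i t + δ i (t +ˡ 2)
surplus 3F t i = δ i t + δ i (t +ˡ 1) + δ i (t +ˡ 2)

abstract
  -- A finite search for the rotation `t` of a new cycle of residue `c`. The two surpluses hold at
  -- most 6 labels together, so at most one full round splits off, which is why `q` lies in `Fin 2`.
  absorb : ∀ s a c → ∃ λ t → ∃ λ s′ → ∃ λ a′ → ∃ λ (q : Fin 2) →
    ∀ i → surplus c t i + surplus s a i ≡ toℕ q + surplus s′ a′ i
  absorb = from-yes (all? λ s → all? λ a → all? λ c → any? λ t → any? λ s′ → any? λ a′ → any? λ (q : Fin 2) →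
    all? λ i → surplus c t i + surplus s a i ≟ toℕ q + surplus s′ a′ i)

round : ∀ t i → δ i t + δ i (t +ˡ 1) + δ i (t +ˡ 2) + δ i (t +ˡ 3) ≡ 1
round = from-yes (all? λ t → all? λ i → δ i t + δ i (t +ˡ 1) + δ i (t +ˡ 2) + δ i (t +ˡ 3) ≟ 1)

+ˡ-cycle : ∀ t → t ≡ t +ˡ 4
+ˡ-cycle = from-yes (all? λ t → t ≟ᶠ t +ˡ 4)

-- Reduction mod 4 by recursion, so that the recursive case of `closed-walk` keeps its surplus
-- definitionally.
residue : ℕ → Fin 4
residue 0 = 0F
residue 1 = 1F
residue 2 = 2F
residue 3 = 3F
residue (suc (suc (suc (suc k)))) = residue k

-- A 4 by `K` grid on the vertices, with labels as rows. By `hub`, `f` preserves the rank on label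
-- 0; this becomes the complementation of the remaining coordinates on layer 0.
record Layout {n} (f : F n) (K : ℕ) : Set where
  field
    label       : Config n → Fin 4
    rank        : Config n → Fin K
    place       : Fin 4 → Fin K → Config n
    place-rank  : ∀ v → place (label v) (rank v) ≡ v
    label-place : ∀ i k → label (place i k) ≡ i
    rank-place  : ∀ i k → rank (place i k) ≡ k
    label-step  : ∀ v → Step (label v) (label (f v))
    hub         : ∀ k → f (place 0F k) ≡ place 1F k ⊎ f (place 0F k) ≡ place 2F k

-- Cycles and their labellings

least : {P : ℕ → Set} → (∀ k → Dec (P k)) → ∀ k → P k → ∃ λ m → P m × (∀ {j} → j < m → ¬ P j)
least P? k pk with P? 0
... | yes p0 = 0 , p0 , λ ()
least P? zero    pk | no ¬p0 = contradiction pk ¬p0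
least P? (suc k) pk | no ¬p0 with least (P? ∘ suc) k pk
... | m , pm , below = suc m , pm , λ { {zero} _ → ¬p0 ; {suc j} (s≤s j<m) → below j<m }

module Labelling {n} (f : F n) where

  private V = Config n

  iter : ℕ → V → V
  iter zero    x = x
  iter (suc k) x = iter k (f x)

  iter-+ : ∀ j k x → iter (j + k) x ≡ iter k (iter j x)
  iter-+ zero    k x = refl
  iter-+ (suc j) k x = iter-+ j k (f x)

  iter-suc : ∀ k x → iter k (f x) ≡ f (iter k x)
  iter-suc zero    x = refl
  iter-suc (suc k) x = iter-suc k (f x)

  orbit : ℕ → V → List V
  orbit zero    x = []
  orbit (suc k) x = x ∷ orbit k (f x)

  -- A stretch of the trajectory of x, labelled from l on, with y and m the vertex and label that follow.
  data Walk : V → Fin 4 → List (V × Fin 4) → V → Fin 4 → Set where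
    []  : ∀ {x l} → Walk x l [] x l
    _∷_ : ∀ {x l l′ xs y m} → Step l l′ → Walk (f x) l′ xs y m → Walk x l ((x , l) ∷ xs) y m

  walk-end : ∀ {x l xs y m} → Walk x l xs y m → y ≡ iter (length xs) x
  walk-end []      = refl
  walk-end (_ ∷ w) = walk-end w

  walk-keys : ∀ {x l xs y m} → Walk x l xs y m → map proj₁ xs ≡ orbit (length xs) x
  walk-keys []      = refl
  walk-keys (_ ∷ w) = cong (_ ∷_) (walk-keys w)

  -- The successor of the last entry is the end pair, hence the appended `(y , m)`; for a walk back
  -- to its start this pair is the first entry.
  walk-next : ∀ {x l xs y m v k} → Walk x l xs y m → (v , k) ∈ xs →
    ∃ λ k′ → Step k k′ × (f v , k′) ∈ xs ++ (y , m) ∷ []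
  walk-next (s ∷ [])        (here refl) = _ , s , there (here refl)
  walk-next (s ∷ w@(_ ∷ _)) (here refl) = _ , s , there (here refl)
  walk-next (s ∷ w)         (there v∈)  = let _ , s′ , v′∈ = walk-next w v∈ in _ , s′ , there v′∈

  Closed : List (V × Fin 4) → Set
  Closed xs = ∀ {v l} → (v , l) ∈ xs → ∃ λ l′ → Step l l′ × (f v , l′) ∈ xs

  walk-closed : ∀ {x t xs} → Walk x t xs x t → Closed xs
  walk-closed w@(_ ∷ _) v∈ with walk-next w v∈
  ... | l′ , s , v′∈ with ∈-++⁻ _ v′∈
  ...   | inj₁ v′∈xs       = l′ , s , v′∈xs
  ...   | inj₂ (here refl) = l′ , s , here refl

  -- The words t t+2, t t+1 t+2, t t+1 t+2 t+3 and t t+2 t+3 t+1 t+3 all lead back to t, so that they can be concatenated.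
  closed-walk : ∀ k x t → ∃ λ xs → ∃ λ y → Walk x t xs y t × length xs ≡ 2 + k ×
    ∃ λ q → ∀ i → count i xs ≡ q + surplus (residue (2 + k)) t i
  closed-walk 0 x t = _ , _ , inj₂ refl ∷ inj₂ (+ˡ-cycle t) ∷ [] , refl , 0 , λ i → cong (δ i t +_) (+-identityʳ _)
  closed-walk 1 x t = _ , _ , inj₁ refl ∷ inj₁ refl ∷ inj₂ (+ˡ-cycle t) ∷ [] , refl , 0 , λ i →
    solve 3 (λ a b c → a :+ (b :+ (c :+ con 0)) := a :+ b :+ c) refl (δ i t) (δ i (t +ˡ 1)) (δ i (t +ˡ 2))
    where open +-*-Solver
  closed-walk 2 x t = _ , _ , inj₁ refl ∷ inj₁ refl ∷ inj₁ refl ∷ inj₁ (+ˡ-cycle t) ∷ [] , refl , 1 , λ i → trans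
    (solve 4 (λ a b c d → a :+ (b :+ (c :+ (d :+ con 0))) := a :+ b :+ c :+ d) refl
      (δ i t) (δ i (t +ˡ 1)) (δ i (t +ˡ 2)) (δ i (t +ˡ 3)))
    (round t i)
    where open +-*-Solver
  -- The repeated label is t+3, whence the offset in `surplus 1F`. The step from t+3 to t+1 has size
  -- 2, as t+5 = t+1.
  closed-walk 3 x t =
    _ , _ , inj₂ refl ∷ inj₁ refl ∷ inj₂ (cong next (+ˡ-cycle t)) ∷ inj₂ refl ∷ inj₁ (+ˡ-cycle t) ∷ [] , refl , 1 ,
    λ i → trans
      (solve 4 (λ a b c d → a :+ (c :+ (d :+ (b :+ (d :+ con 0)))) := a :+ b :+ c :+ d :+ d) refl
        (δ i t) (δ i (t +ˡ 1)) (δ i (t +ˡ 2)) (δ i (t +ˡ 3)))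
      (cong (_+ δ i (t +ˡ 3)) (round t i))
    where open +-*-Solver
  closed-walk (suc (suc (suc (suc k)))) x t =
    let xs , y , w , len , q , c = closed-walk k (iter 4 x) t
    in  _ , y , inj₁ refl ∷ inj₁ refl ∷ inj₁ refl ∷ inj₁ (+ˡ-cycle t) ∷ w , cong (4 +_) len , suc q , λ i → trans
        (solve 5 (λ a b c d z → a :+ (b :+ (c :+ (d :+ z))) := a :+ b :+ c :+ d :+ z) refl
          (δ i t) (δ i (t +ˡ 1)) (δ i (t +ˡ 2)) (δ i (t +ˡ 3)) _)
        (cong₂ _+_ (round t i) (c i))
    where open +-*-Solver

  module _ (f-injective : Injective _≡_ _≡_ f) (f-free : ∀ x → f x ≢ x) where

    iter-injective : ∀ k {x y} → iter k x ≡ iter k y → x ≡ y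
    iter-injective zero    eq = eq
    iter-injective (suc k) eq = f-injective (iter-injective k eq)

    -- Among 2ⁿ + 1 iterates two coincide, at times i < j; injectivity cancels the first i steps and
    -- leaves a return after j - i.
    returns : ∀ x → ∃ λ k → iter (suc k) x ≡ x
    returns x with pigeonhole (n<1+n (2 ^ n)) (λ i → encode (iter (toℕ i) x))
    ... | i , j , i<j , eq = toℕ j ∸ suc (toℕ i) , iter-injective (toℕ i) (begin
      iter (toℕ i) (iter (suc (toℕ j ∸ suc (toℕ i))) x) ≡⟨ iter-+ (suc (toℕ j ∸ suc (toℕ i))) (toℕ i) x ⟨
      iter (suc (toℕ j ∸ suc (toℕ i)) + toℕ i) x        ≡⟨ cong (λ k → iter k x) (trans (sym (+-suc (toℕ j ∸ suc (toℕ i)) (toℕ i))) (m∸n+n≡m {toℕ j} i<j)) ⟩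
      iter (toℕ j) x                                    ≡⟨ decode-encode _ ⟨
      decode (encode (iter (toℕ j) x))                  ≡⟨ cong decode eq ⟨
      decode (encode (iter (toℕ i) x))                  ≡⟨ decode-encode _ ⟩
      iter (toℕ i) x                                    ∎)
      where open ≡-Reasoning

    ∈-orbit : ∀ {k x v} → v ∈ orbit k x → ∃ λ j → j < k × v ≡ iter j x
    ∈-orbit {suc k} (here refl) = 0 , s≤s z≤n , refl
    ∈-orbit {suc k} (there v∈)  = let j , j<k , eq = ∈-orbit v∈ in suc j , s≤s j<k , eq

    -- By injectivity a repetition anywhere in the orbit pulls back to an early return to its first
    -- vertex.
    orbit-unique : ∀ k x → (∀ {j} → suc j < k → iter (suc j) x ≢ x) → Unique (orbit k x)
    orbit-unique zero    x _ = []
    orbit-unique (suc k) x ≢x =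
      All.tabulate (λ v∈ x≡v → let j , j<k , eq = ∈-orbit v∈ in ≢x (s≤s j<k) (sym (trans x≡v eq))) ∷
      orbit-unique k (f x) λ {j} j+1<k eq → ≢x (m≤n⇒m≤1+n j+1<k) (f-injective (trans (sym (iter-suc (suc j) x)) eq))

    -- The least return time is the cycle length; it is not 1 because `f` has no fixed point, hence
    -- the form `2 + k`.
    cycle : ∀ x → ∃ λ k → iter (2 + k) x ≡ x × Unique (orbit (2 + k) x)
    cycle x with least (λ k → iter (suc k) x ≟ᶜ x) (proj₁ (returns x)) (proj₂ (returns x))
    ... | zero  , eq , _     = contradiction eq (f-free x)
    ... | suc k , eq , below = k , eq , orbit-unique (2 + k) x λ { (s≤s j<) → below j< }

    -- Covering the hypercube by labelled cycles

    Balanced : List (V × Fin 4) → Set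
    Balanced xs = ∃ λ s → ∃ λ a → ∃ λ q → ∀ i → count i xs ≡ q + surplus s a i

    record Partial : Set where
      field
        entries  : List (V × Fin 4)
        unique   : Unique (map proj₁ entries)
        closed   : Closed entries
        balanced : Balanced entries

      Covers : V → Set
      Covers v = v ∈ map proj₁ entries

    open Partial

    covers-iter : ∀ (p : Partial) {v} k → Covers p v → Covers p (iter k v)
    covers-iter p zero    v∈ = v∈
    covers-iter p (suc k) v∈ with ∈-map⁻ proj₁ v∈
    ... | _ , vl∈ , refl = covers-iter p k (∈-map⁺ proj₁ (proj₂ (proj₂ (closed p vl∈))))

    -- The whole cycle of `v` is added, labelled from the `t` that `absorb` selects for the present
    -- surplus; this keeps the list balanced.
    insert : ∀ p v → ¬ Covers p v → ∃ λ p′ → Covers p′ v × (∀ {w} → Covers p w → Covers p′ w)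
    insert p v v∉ with cycle v
    ... | k , return , orbit! with balanced p
    ... | s , a , q , c with absorb s a (residue (2 + k))
    ... | t , s′ , a′ , r , e with closed-walk k v t
    -- Matching on the nonempty walk reveals that its first key is `v`, so `v` is covered by
    -- `here refl`.
    ... | xs@(_ ∷ _) , y , w@(_ ∷ _) , len , q′ , c′ =
      record { entries = xs ++ entries p ; unique = unique′ ; closed = closed′ ; balanced = s′ , a′ , q + q′ + toℕ r , balanced′ }
      , here refl , λ {u} u∈ → subst (u ∈_) (sym (map-++ proj₁ xs (entries p))) (∈-++⁺ʳ (map proj₁ xs) u∈)
      where
      keys : map proj₁ xs ≡ orbit (2 + k) v
      keys = trans (walk-keys w) (cong (λ j → orbit j v) len)

      y≡v : y ≡ v
      y≡v = trans (walk-end w) (trans (cong (λ j → iter j v) len) return)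

      -- The old entries are closed under `f`: following `f` from a shared vertex around the rest of
      -- the cycle would show `v` already covered.
      disjoint : ∀ {u} → ¬ (u ∈ map proj₁ xs × u ∈ map proj₁ (entries p))
      disjoint {u} (u∈ , u∈p) with ∈-orbit {2 + k} {v} (subst (u ∈_) keys u∈)
      ... | j , j<k , refl = v∉ (subst (Covers p)
        (trans (sym (iter-+ j _ v)) (trans (cong (λ m → iter m v) (m+[n∸m]≡n (<⇒≤ j<k))) return))
        (covers-iter p (2 + k ∸ j) u∈p))

      unique′ : Unique (map proj₁ (xs ++ entries p))
      unique′ = subst Unique (sym (map-++ proj₁ xs (entries p)))
        (Unique.++⁺ (subst Unique (sym keys) orbit!) (unique p) disjoint)

      closed′ : Closed (xs ++ entries p)
      closed′ u∈ with ∈-++⁻ xs u∈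
      ... | inj₁ u∈xs = let l , step , u′∈ = walk-closed (subst (λ z → Walk v t xs z t) y≡v w) u∈xs in l , step , ∈-++⁺ˡ u′∈
      ... | inj₂ u∈p  = let l , step , u′∈ = closed p u∈p in l , step , ∈-++⁺ʳ xs u′∈

      balanced′ : ∀ i → count i (xs ++ entries p) ≡ q + q′ + toℕ r + surplus s′ a′ i
      balanced′ i = begin
        count i (xs ++ entries p)                                     ≡⟨ count-++ i xs (entries p) ⟩
        count i xs + count i (entries p)                              ≡⟨ cong₂ _+_ (c′ i) (c i) ⟩
        (q′ + surplus (residue (2 + k)) t i) + (q + surplus s a i)    ≡⟨ regroup q′ _ q _ ⟩
        (q + q′) + (surplus (residue (2 + k)) t i + surplus s a i)    ≡⟨ cong ((q + q′) +_) (e i) ⟩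
        (q + q′) + (toℕ r + surplus s′ a′ i)                          ≡⟨ +-assoc (q + q′) _ _ ⟨
        q + q′ + toℕ r + surplus s′ a′ i                              ∎
        where
        open ≡-Reasoning
        regroup : ∀ a b c d → (a + b) + (c + d) ≡ (c + a) + (b + d)
        regroup = solve 4 (λ a b c d → (a :+ b) :+ (c :+ d) := (c :+ a) :+ (b :+ d)) refl
          where open +-*-Solver

    open import Data.List.Membership.DecPropositional (_≟ᶜ_ {n}) using (_∈?_)

    cover : ∀ vs p → ∃ λ p′ → (∀ {v} → v ∈ vs → Covers p′ v) × (∀ {w} → Covers p w → Covers p′ w)
    cover []       p = p , (λ ()) , id
    cover (v ∷ vs) p with v ∈? map proj₁ (entries p)
    ... | yes v∈ = let p′ , vs∈ , ⊆ = cover vs p in p′ , (λ { (here refl) → ⊆ v∈ ; (there u∈) → vs∈ u∈ }) , ⊆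
    ... | no  v∉ =
      let p₁ , v∈ , ⊆₁ = insert p v v∉
          p₂ , vs∈ , ⊆₂ = cover vs p₁
      in  p₂ , (λ { (here refl) → ⊆₂ v∈ ; (there u∈) → vs∈ u∈ }) , ⊆₂ ∘ ⊆₁

    covering : ∃ λ p → ∀ v → Covers p v
    covering =
      let p , all∈ , _ = cover (configs n) (record
            { entries = [] ; unique = [] ; closed = λ () ; balanced = 0F , 0F , 0 , λ _ → refl })
      in  p , λ v → all∈ (∈-configs v)

    covering-length : ∀ p → (∀ v → Covers p v) → length (entries p) ≡ 2 ^ n
    covering-length p all∈ = begin
      length (entries p)             ≡⟨ length-map proj₁ (entries p) ⟨
      length (map proj₁ (entries p)) ≡⟨ ≤-antisym (bound (unique p) (λ _ → ∈-configs _)) (bound (configs-unique n) (λ _ → all∈ _)) ⟩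
      length (configs n)             ≡⟨ length-configs n ⟩
      2 ^ n                          ∎
      where
      open ≡-Reasoning
      bound : {xs ys : List V} → Unique xs → (∀ {x} → x ∈ xs → x ∈ ys) → length xs ≤ length ys
      bound {xs} u sub = let zs , perm = extract u sub in
        subst (length xs ≤_) (sym (trans (↭-length perm) (length-++ xs))) (m≤m+n (length xs) (length zs))

    -- Summing over the labels gives `toℕ s + q * 4 ≡ K * 4`. So 4 divides `toℕ s`, which is less
    -- than 4; the surplus is empty and every count is `q`, which equals `K`.
    covering-count : ∀ {K} → 2 ^ n ≡ K * 4 → ∀ p → (∀ v → Covers p v) → ∀ i → count i (entries p) ≡ K
    covering-count {K} 2ⁿ≡4K p all∈ i with balanced p
    ... | s , a , q , c = finish s refl
      where
      total : toℕ s + q * 4 ≡ K * 4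
      total = begin
        toℕ s + q * 4 ≡⟨ cong (_+ q * 4) (size s a) ⟨
        surplus s a 0F + surplus s a 1F + surplus s a 2F + surplus s a 3F + q * 4 ≡⟨ regroup (surplus s a 0F) _ _ _ q ⟨
        (q + surplus s a 0F) + (q + surplus s a 1F) + (q + surplus s a 2F) + (q + surplus s a 3F)
          ≡⟨ cong₂ _+_ (cong₂ _+_ (cong₂ _+_ (c 0F) (c 1F)) (c 2F)) (c 3F) ⟨
        count 0F (entries p) + count 1F (entries p) + count 2F (entries p) + count 3F (entries p) ≡⟨ count-total (entries p) ⟩
        length (entries p) ≡⟨ covering-length p all∈ ⟩
        2 ^ n ≡⟨ 2ⁿ≡4K ⟩
        K * 4 ∎
        where
        open ≡-Reasoning
        size : ∀ s a → surplus s a 0F + surplus s a 1F + surplus s a 2F + surplus s a 3F ≡ toℕ s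
        size = from-yes (all? λ s → all? λ a → surplus s a 0F + surplus s a 1F + surplus s a 2F + surplus s a 3F ≟ toℕ s)
        regroup : ∀ a b c d q → (q + a) + (q + b) + (q + c) + (q + d) ≡ a + b + c + d + q * 4
        regroup = solve 5 (λ a b c d q → (q :+ a) :+ (q :+ b) :+ (q :+ c) :+ (q :+ d) := a :+ b :+ c :+ d :+ q :* con 4) refl
          where open +-*-Solver

      mod4 : toℕ s % 4 ≡ 0
      mod4 = trans (sym ([m+kn]%n≡m%n (toℕ s) q 4)) (trans (cong (_% 4) total) (m*n%n≡0 K 4))

      finish : ∀ s′ → s ≡ s′ → count i (entries p) ≡ K
      finish 0F refl = trans (c i) (trans (+-identityʳ q) (*-cancelʳ-≡ q K 4 total))
      finish 1F refl = contradiction mod4 λ ()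
      finish 2F refl = contradiction mod4 λ ()
      finish 3F refl = contradiction mod4 λ ()

    label-unique : ∀ {xs : List (V × Fin 4)} {v l l′} → Unique (map proj₁ xs) → (v , l) ∈ xs → (v , l′) ∈ xs → l ≡ l′
    label-unique u        (here refl) (here refl) = refl
    label-unique (v∉ ∷ u) (here refl) (there v∈)  = contradiction refl (All.lookup v∉ (∈-map⁺ proj₁ v∈))
    label-unique (v∉ ∷ u) (there v∈)  (here refl) = contradiction refl (All.lookup v∉ (∈-map⁺ proj₁ v∈))
    label-unique (_ ∷ u)  (there v∈)  (there v∈′) = label-unique u v∈ v∈′

    -- Arranging the label classes in aligned rows

    module _ {K} (2ⁿ≡4K : 2 ^ n ≡ K * 4) where

      private
        p : Partial
        p = proj₁ covering

        keys : List V
        keys = map proj₁ (entries p)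

        covered : ∀ v → v ∈ keys
        covered = proj₂ covering

      label : V → Fin 4
      label v = proj₂ (proj₁ (∈-map⁻ proj₁ (covered v)))

      label-∈ : ∀ v → (v , label v) ∈ entries p
      label-∈ v with ∈-map⁻ proj₁ (covered v)
      ... | (_ , l) , vl∈ , refl = vl∈

      label-entry : ∀ {v l} → (v , l) ∈ entries p → label v ≡ l
      label-entry vl∈ = label-unique (unique p) (label-∈ _) vl∈

      label-step : ∀ v → Step (label v) (label (f v))
      label-step v =
        let l , step , fv∈ = closed p (label-∈ v)
        in  subst (Step (label v)) (sym (label-entry fv∈)) step

      class : Fin 4 → List V
      class i = filter (λ v → i ≟ᶠ label v) keys

      ∈-class : ∀ {i v} → i ≡ label v → v ∈ class i
      ∈-class = ∈-filter⁺ (λ v → _ ≟ᶠ label v) (covered _)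

      class-label : ∀ {i v} → v ∈ class i → i ≡ label v
      class-label {i} v∈ = proj₂ (∈-filter⁻ (λ v → i ≟ᶠ label v) {xs = keys} v∈)

      class-unique : ∀ i → Unique (class i)
      class-unique i = Unique.filter⁺ (λ v → i ≟ᶠ label v) (unique p)

      length-filter-label : ∀ i {xs} → All (λ (v , l) → label v ≡ l) xs →
        length (filter (λ v → i ≟ᶠ label v) (map proj₁ xs)) ≡ count i xs
      length-filter-label i []                        = refl
      length-filter-label i {(v , _) ∷ _} (refl ∷ ps) with i ≟ᶠ label v
      ... | yes _ = cong suc (length-filter-label i ps)
      ... | no  _ = length-filter-label i ps

      length-class : ∀ i → length (class i) ≡ K
      length-class i = trans (length-filter-label i (All.tabulate label-entry)) (covering-count 2ⁿ≡4K p covered i)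

      to1? : ∀ v → Dec (1F ≡ label (f v))
      to1? v = 1F ≟ᶠ label (f v)

      P₁ P₂ : List V
      P₁ = filter to1? (class 0F)
      P₂ = filter (λ v → ¬? (to1? v)) (class 0F)

      image₁ : ∀ {v} → v ∈ map f P₁ → v ∈ class 1F
      image₁ v∈ with ∈-map⁻ f v∈
      ... | u , u∈ , refl = ∈-class (proj₂ (∈-filter⁻ to1? {xs = class 0F} u∈))

      image₂ : ∀ {v} → v ∈ map f P₂ → v ∈ class 2F
      image₂ v∈ with ∈-map⁻ f v∈
      ... | u , u∈ , refl with ∈-filter⁻ (λ v → ¬? (to1? v)) {xs = class 0F} u∈
      ...   | u∈0 , ≢1 = ∈-class (2-label (label-step u) (class-label u∈0) ≢1)
        where
        2-label : ∀ {l m} → Step l m → 0F ≡ l → 1F ≢ m → 2F ≡ m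
        2-label (inj₁ refl) refl ≢1 = contradiction refl ≢1
        2-label (inj₂ refl) refl _  = refl

      rest₁ : ∃ λ R → class 1F ↭ map f P₁ ++ R
      rest₁ = extract (Unique.map⁺ f-injective (Unique.filter⁺ to1? (class-unique 0F))) image₁

      rest₂ : ∃ λ R → class 2F ↭ map f P₂ ++ R
      rest₂ = extract (Unique.map⁺ f-injective (Unique.filter⁺ (λ v → ¬? (to1? v)) (class-unique 0F))) image₂

      R₁ R₂ : List V
      R₁ = proj₁ rest₁
      R₂ = proj₁ rest₂

      -- The order makes `f` preserve positions on row 0: images of `P₁` open row 1, images of `P₂`
      -- close row 2, and `R₁`, `R₂` fill the gaps.
      row : Fin 4 → List V
      row 0F = P₁ ++ P₂
      row 1F = map f P₁ ++ R₁
      row 2F = R₂ ++ map f P₂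
      row 3F = class 3F

      row-↭ : ∀ i → class i ↭ row i
      row-↭ 0F = filter-split to1? (class 0F)
      row-↭ 1F = proj₂ rest₁
      row-↭ 2F = ↭-trans (proj₂ rest₂) (++-comm (map f P₂) R₂)
      row-↭ 3F = ↭-refl

      length-row : ∀ i → length (row i) ≡ K
      length-row i = trans (sym (↭-length (row-↭ i))) (length-class i)

      row-unique : ∀ i → Unique (row i)
      row-unique i = Unique-resp-↭ (setoid V) (↭⇒↭ₛ (row-↭ i)) (class-unique i)

      -- Rows 0 and 2 have equal length and end in blocks of equal length, so `P₂` and its image
      -- start at the same position.
      length-R₂ : length R₂ ≡ length P₁
      length-R₂ = +-cancelʳ-≡ (length P₂) (length R₂) (length P₁) (begin
        length R₂ + length P₂         ≡⟨ cong (length R₂ +_) (length-map f P₂) ⟨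
        length R₂ + length (map f P₂) ≡⟨ length-++ R₂ ⟨
        length (row 2F)               ≡⟨ length-row 2F ⟩
        K                             ≡⟨ length-row 0F ⟨
        length (row 0F)               ≡⟨ length-++ P₁ ⟩
        length P₁ + length P₂         ∎)
        where open ≡-Reasoning

      place : Fin 4 → Fin K → V
      place i = at (row i) (length-row i)

      ranked : ∀ v → ∃ λ k → place (label v) k ≡ v
      ranked v = ∈⇒at (length-row (label v)) (∈-resp-↭ (row-↭ (label v)) (∈-class refl))

      label-place : ∀ i k → label (place i k) ≡ i
      label-place i k = sym (class-label (∈-resp-↭ (↭-sym (row-↭ i)) (at-∈ (row i) (length-row i) k)))

      rank-unique : ∀ v k → place (label v) k ≡ v → proj₁ (ranked v) ≡ k
      rank-unique v k eq = at-injective (row-unique (label v)) (length-row (label v)) (trans (proj₂ (ranked v)) (sym eq))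

      layout : Layout f K
      layout = record
        { label       = label
        ; rank        = proj₁ ∘ ranked
        ; place       = place
        ; place-rank  = proj₂ ∘ ranked
        ; label-place = label-place
        ; rank-place  = λ i k → rank-unique (place i k) k (cong (λ j → place j k) (label-place i k))
        ; label-step  = label-step
        ; hub         = at-aligned f P₁ R₂ (length-row 0F) (length-row 1F) (length-row 2F) length-R₂
        }

-- Paths in asynchronous graphs

infixr 5 _++ᵖ_

_++ᵖ_ : ∀ {n} {h : F n} {x y z j k} → Path h x y j → Path h y z k → Path h x z (j + k)
[]      ++ᵖ q = q
(a ∷ p) ++ᵖ q = a ∷ (p ++ᵖ q)

-- The differing coordinates are flipped from first to last. Coordinates already treated are moved
-- into `embed`, which also allows a fixed prefix.
geodesic : ∀ {n k} {h : F n} (embed : Config k → Config n) →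
  (∀ r i → AsyncArc h (embed r) (embed (flip r i))) → ∀ r r′ → Path h (embed r) (embed r′) (hamming r r′)
geodesic embed arc []          []           = []
geodesic embed arc (false ∷ r) (false ∷ r′) = geodesic (embed ∘ (false ∷_)) (λ r i → arc _ (suc i)) r r′
geodesic embed arc (false ∷ r) (true  ∷ r′) = arc _ 0F ∷ geodesic (embed ∘ (true ∷_)) (λ r i → arc _ (suc i)) r r′
geodesic embed arc (true  ∷ r) (false ∷ r′) = arc _ 0F ∷ geodesic (embed ∘ (false ∷_)) (λ r i → arc _ (suc i)) r r′
geodesic embed arc (true  ∷ r) (true  ∷ r′) = geodesic (embed ∘ (true ∷_)) (λ r i → arc _ (suc i)) r r′

all-Bool? : {P : Bool → Set} → (∀ b → Dec (P b)) → Dec (∀ b → P b)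
all-Bool? P? = map′ (λ { (p , q) false → p ; (p , q) true → q }) (λ p → p false , p true) (P? false ×-dec P? true)

differ : Bool → Bool → ℕ
differ a b = hamming (a ∷ []) (b ∷ [])

-- Separates the two prefix coordinates from the rest, so that their share of the bound is a finite
-- check.
hamming-∷ : ∀ {n} a b (x y : Config n) → hamming (a ∷ x) (b ∷ y) ≡ differ a b + hamming x y
hamming-∷ false false x y = refl
hamming-∷ false true  x y = refl
hamming-∷ true  false x y = refl
hamming-∷ true  true  x y = refl

-- The asynchronous graph of a layout

module Conjugate {m} (f : F (2 + m)) (L : Layout f (2 ^ m)) where

  open Layout L

  -- Layers 0, 1, 2, 3 are the prefixes 00, 10, 11, 01; layers 1 and 2 list their columns complemented, so that f
  -- sends layer 0 to complementary columns.
  locate : Fin 4 → Fin (2 ^ m) → Config (2 + m)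
  locate 0F k = false ∷ false ∷ decode k
  locate 1F k = true  ∷ false ∷ Vec.map not (decode k)
  locate 2F k = true  ∷ true  ∷ Vec.map not (decode k)
  locate 3F k = false ∷ true  ∷ decode k

  layer : Config (2 + m) → Fin 4
  layer (false ∷ false ∷ r) = 0F
  layer (true  ∷ false ∷ r) = 1F
  layer (true  ∷ true  ∷ r) = 2F
  layer (false ∷ true  ∷ r) = 3F

  column : Config (2 + m) → Fin (2 ^ m)
  column (false ∷ _ ∷ r) = encode r
  column (true  ∷ _ ∷ r) = encode (Vec.map not r)

  map-not-involutive : ∀ {k} (r : Config k) → Vec.map not (Vec.map not r) ≡ r
  map-not-involutive r = trans (sym (map-∘ not not r)) (trans (map-cong not-involutive r) (map-id r))

  layer-locate : ∀ i k → layer (locate i k) ≡ i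
  layer-locate 0F k = refl
  layer-locate 1F k = refl
  layer-locate 2F k = refl
  layer-locate 3F k = refl

  encode-not-not : ∀ k → encode (Vec.map not (Vec.map not (decode {m} k))) ≡ k
  encode-not-not k = trans (cong encode (map-not-involutive (decode {m} k))) (encode-decode {m} k)

  column-locate : ∀ i k → column (locate i k) ≡ k
  column-locate 0F k = encode-decode {m} k
  column-locate 1F k = encode-not-not k
  column-locate 2F k = encode-not-not k
  column-locate 3F k = encode-decode {m} k

  not-decode-encode : ∀ (r : Config m) → Vec.map not (decode (encode (Vec.map not r))) ≡ r
  not-decode-encode r = trans (cong (Vec.map not) (decode-encode _)) (map-not-involutive r)

  locate-layer : ∀ x → locate (layer x) (column x) ≡ x
  locate-layer (false ∷ false ∷ r) = cong (λ r → false ∷ false ∷ r) (decode-encode r)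
  locate-layer (true  ∷ false ∷ r) = cong (λ r → true ∷ false ∷ r) (not-decode-encode r)
  locate-layer (true  ∷ true  ∷ r) = cong (λ r → true ∷ true ∷ r) (not-decode-encode r)
  locate-layer (false ∷ true  ∷ r) = cong (λ r → false ∷ true ∷ r) (decode-encode r)

  -- Mutually inverse relabellings that match label with layer and rank with column; `h` is the
  -- conjugate of `f` by them.
  φ ψ : Config (2 + m) → Config (2 + m)
  φ v = locate (label v) (rank v)
  ψ x = place (layer x) (column x)

  φ-ψ : ∀ x → φ (ψ x) ≡ x
  φ-ψ x = trans (cong₂ locate (label-place (layer x) (column x)) (rank-place (layer x) (column x))) (locate-layer x)

  ψ-φ : ∀ v → ψ (φ v) ≡ v
  ψ-φ v = trans (cong₂ place (layer-locate (label v) (rank v)) (column-locate (label v) (rank v))) (place-rank v)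

  φ-injective : ∀ {v w} → φ v ≡ φ w → v ≡ w
  φ-injective {v} {w} eq = trans (sym (ψ-φ v)) (trans (cong ψ eq) (ψ-φ w))

  h : F (2 + m)
  h x = φ (f (ψ x))

  similar : Similar f h
  similar = mk⤖ (φ-injective , λ y → ψ y , λ { refl → φ-ψ y }) , λ x y → mk⇔
    (λ eq → trans (cong φ eq) (cong (φ ∘ f) (sym (ψ-φ x))))
    (λ eq → φ-injective (trans eq (cong (φ ∘ f) (ψ-φ x))))

  locate-hub : ∀ r i → f (place 0F (encode r)) ≡ place i (encode r) → h (false ∷ false ∷ r) ≡ locate i (encode r)
  locate-hub r i eq = trans (cong φ eq) (cong₂ locate (label-place i _) (rank-place i _))

  -- `f` keeps the column here and lands in layer 1 or 2, where columns are listed complemented.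
  -- Only the second coordinate `b` depends on which layer it is.
  hub-value : ∀ r → ∃ λ b → h (false ∷ false ∷ r) ≡ true ∷ b ∷ Vec.map not r
  hub-value r with hub (encode r)
  ... | inj₁ eq = false , trans (locate-hub r 1F eq) (cong (λ r → true ∷ false ∷ Vec.map not r) (decode-encode r))
  ... | inj₂ eq = true  , trans (locate-hub r 2F eq) (cong (λ r → true ∷ true ∷ Vec.map not r) (decode-encode r))

  h-step : ∀ x → Step (layer x) (label (f (ψ x)))
  h-step x = subst (λ l → Step l (label (f (ψ x)))) (label-place (layer x) (column x)) (label-step (ψ x))

  hub-up : ∀ r → AsyncArc h (false ∷ false ∷ r) (true ∷ false ∷ r)
  hub-up r = 0F , (λ eq → true≢false (trans (sym (cong (λ z → lookup z 0F) (proj₂ (hub-value r)))) eq)) , refl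
    where
    true≢false : true ≢ false
    true≢false ()

  hub-move : ∀ r i → AsyncArc h (false ∷ false ∷ r) (false ∷ false ∷ flip r i)
  hub-move r i = suc (suc i) , (λ eq → not-¬ refl (trans (sym eq)
    (trans (cong (λ z → lookup z (suc (suc i))) (proj₂ (hub-value r))) (lookup-map i not r)))) , refl

  -- Layers l+1 and l+2 agree in the prefix coordinate in which l and l+1 differ. Hence `h` changes
  -- that coordinate in either case; the same holds for layers 2 and 3 below.
  layer₁-arc : ∀ r → AsyncArc h (true ∷ false ∷ r) (true ∷ true ∷ r)
  layer₁-arc r = 1F , differs (h-step (true ∷ false ∷ r)) , refl
    where
    differs : ∀ {l k} → Step 1F l → lookup (locate l k) 1F ≢ false
    differs (inj₁ refl) ()
    differs (inj₂ refl) ()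

  layer₂-arc : ∀ r → AsyncArc h (true ∷ true ∷ r) (false ∷ true ∷ r)
  layer₂-arc r = 0F , differs (h-step (true ∷ true ∷ r)) , refl
    where
    differs : ∀ {l k} → Step 2F l → lookup (locate l k) 0F ≢ true
    differs (inj₁ refl) ()
    differs (inj₂ refl) ()

  layer₃-arc : ∀ r → AsyncArc h (false ∷ true ∷ r) (false ∷ false ∷ r)
  layer₃-arc r = 1F , differs (h-step (false ∷ true ∷ r)) , refl
    where
    differs : ∀ {l k} → Step 3F l → lookup (locate l k) 1F ≢ true
    differs (inj₁ refl) ()
    differs (inj₂ refl) ()

  -- Paths through layer 0

  exit-length entry-length : Bool → Bool → ℕ
  exit-length false false = 0
  exit-length true  false = 3
  exit-length true  true  = 2
  exit-length false true  = 1
  entry-length false false = 0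
  entry-length true  false = 1
  entry-length true  true  = 2
  entry-length false true  = 3

  exit : ∀ a b r → Path h (a ∷ b ∷ r) (false ∷ false ∷ r) (exit-length a b)
  exit false false r = []
  exit true  false r = layer₁-arc r ∷ layer₂-arc r ∷ layer₃-arc r ∷ []
  exit true  true  r = layer₂-arc r ∷ layer₃-arc r ∷ []
  exit false true  r = layer₃-arc r ∷ []

  entry : ∀ a b r → Path h (false ∷ false ∷ r) (a ∷ b ∷ r) (entry-length a b)
  entry false false r = []
  entry true  false r = hub-up r ∷ []
  entry true  true  r = hub-up r ∷ layer₁-arc r ∷ []
  entry false true  r = hub-up r ∷ layer₁-arc r ∷ layer₂-arc r ∷ []

  paths : ∀ x y → ∃ λ k → k ≤ hamming x y + 4 × Path h x y k
  paths (a ∷ b ∷ r) (a′ ∷ b′ ∷ r′) =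
    exit-length a b + (hamming r r′ + entry-length a′ b′) ,
    bound ,
    exit a b r ++ᵖ geodesic (λ r → false ∷ false ∷ r) hub-move r r′ ++ᵖ entry a′ b′ r′
    where
    -- Checked on the 16 pairs of prefixes; it is tight, for instance, from 10 to 01, where 3 + 3 =
    -- 2 + 4.
    prefix-bound : ∀ a b a′ b′ → exit-length a b + entry-length a′ b′ ≤ differ a a′ + (differ b b′ + 4)
    prefix-bound = from-yes (all-Bool? λ a → all-Bool? λ b → all-Bool? λ a′ → all-Bool? λ b′ →
      exit-length a b + entry-length a′ b′ ≤? differ a a′ + (differ b b′ + 4))

    bound : exit-length a b + (hamming r r′ + entry-length a′ b′) ≤ hamming (a ∷ b ∷ r) (a′ ∷ b′ ∷ r′) + 4
    bound = begin
      exit-length a b + (hamming r r′ + entry-length a′ b′)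
        ≡⟨ solve 3 (λ p z q → p :+ (z :+ q) := p :+ q :+ z) refl (exit-length a b) (hamming r r′) (entry-length a′ b′) ⟩
      exit-length a b + entry-length a′ b′ + hamming r r′
        ≤⟨ +-monoˡ-≤ (hamming r r′) (prefix-bound a b a′ b′) ⟩
      differ a a′ + (differ b b′ + 4) + hamming r r′
        ≡⟨ solve 3 (λ d e z → d :+ (e :+ con 4) :+ z := d :+ (e :+ z) :+ con 4) refl (differ a a′) (differ b b′) (hamming r r′) ⟩
      differ a a′ + (differ b b′ + hamming r r′) + 4
        ≡⟨ cong (λ z → differ a a′ + z + 4) (hamming-∷ b b′ r r′) ⟨
      differ a a′ + hamming (b ∷ r) (b′ ∷ r′) + 4
        ≡⟨ cong (_+ 4) (hamming-∷ a a′ (b ∷ r) (b′ ∷ r′)) ⟨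
      hamming (a ∷ b ∷ r) (a′ ∷ b′ ∷ r′) + 4 ∎
      where
      open ≤-Reasoning
      open +-*-Solver using (solve; _:+_; _:=_; con)

-- The theorem, with dimensions 0 and 1 treated separately

permutation-injective : ∀ {n} {f : F n} → IsPermutation f → Injective _≡_ _≡_ f
permutation-injective (g , gf , _) {x} {y} eq = trans (sym (gf x)) (trans (cong g eq) (gf y))

-- Without a fixed point, `f` must swap the two configurations, so both arcs are present and
-- geodesics suffice.
swap-paths : ∀ {f : F 1} → (∀ x → f x ≢ x) → ∀ x y → ∃ λ k → k ≤ hamming x y + 4 × Path f x y k
swap-paths {f} f-free x y = hamming x y , m≤m+n _ 4 , geodesic id arc x y
  where
  arc : ∀ x i → AsyncArc f x (flip x i)
  arc x@(_ ∷ []) 0F = 0F , (λ eq → f-free x (singleton (f x) x eq)) , refl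
    where
    singleton : ∀ (x y : Config 1) → lookup x 0F ≡ lookup y 0F → x ≡ y
    singleton (a ∷ []) (.a ∷ []) refl = refl

theorem9 : ∀ (n : ℕ) (f : F n) → IsDerangement f →
    Σ (F n) λ h → Similar f h ×
    (∀ x y → ∃ λ k → k ≤ hamming x y + 4 × Path h x y k)
theorem9 zero f (_ , f-free) = contradiction (unit (f [])) (f-free [])
  where
  unit : ∀ (x : Config 0) → x ≡ []
  unit [] = refl
theorem9 (suc zero) f (_ , f-free) =
  f , (mk⤖ (id , λ y → y , id) , λ x y → mk⇔ id id) , swap-paths f-free
-- Two coordinates name the layer and the other m the column, so each label class has `K` = 2^m
-- vertices.
theorem9 (suc (suc m)) f (f-perm , f-free) = h , similar , paths
  where
  2^[2+m]≡2^m*4 : 2 ^ (2 + m) ≡ 2 ^ m * 4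
  2^[2+m]≡2^m*4 = trans (sym (*-assoc 2 2 (2 ^ m))) (*-comm 4 (2 ^ m))
  open Conjugate f (Labelling.layout f (permutation-injective f-perm) f-free 2^[2+m]≡2^m*4)
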